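{- For every set $\Gamma\cup\{\varphi\}\subseteq For(\Sigma)$, if $\Gamma\vDash_{DmbCcl}\varphi$, then $\Gamma\vdash_{DmbCcl}\varphi$.
   Context: **Syntax.** $For(\Sigma)$ is the set of formulas generated from a denumerable set of propositional variables by the signature $\Sigma=\{\to,\neg,\lor,\land,\mathsf{O},\circ\}$ ($\neg,\mathsf{O},\circ$ unary; $\to,\lor,\land$ binary). **The logic $DmbCcl$.** Hilbert calculus whose axiom schemas are those of $CPL^+$, the positive fragment of classical propositional logic in $\to,\land,\lor$ (for instance: $\alpha\to(\beta\to\alpha)$; $(\alpha\to(\beta\to\gamma))\to((\alpha\to\beta)\to(\alpha\to\gamma))$; $\alpha\to(\beta\to(\alpha\land\beta))$; $(\alpha\land\beta)\to\alpha$; $(\alpha\land\beta)\to\beta$; $\alpha\to(\alpha\lor\beta)$; $\beta\to(\alpha\lor\beta)$; $(\alpha\to\gamma)\to((\beta\to\gamma)\to((\alpha\lor\beta)\to\gamma))$; $\alpha\lor(\alpha\to\beta)$), plus (EM) $\alpha\lor\neg\alpha$; (bc) $\circ\alpha\to(\alpha\to(\neg\alpha\to\beta))$; ($\mathsf{O}$-K) $\mathsf{O}(\alpha\to\beta)\to(\mathsf{O}\alpha\to\mathsf{O}\beta)$; ($\mathsf{O}$-E) $\mathsf{O}\bot_\alpha\to\bot_\alpha$, where $\bot_\alpha:=(\alpha\land\neg\alpha)\land\circ\alpha$; and (cl) $\neg(\alpha\land\neg\alpha)\to\circ\alpha$. The rules are Modus Ponens and $\mathsf{O}$-necessitation (from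 $\varphi$ infer $\mathsf{O}\varphi$). $\vdash_{DmbCcl}\varphi$ means that there is a finite derivation of $\varphi$ from axioms (no premises) using the rules. $\Gamma\vdash_{DmbCcl}\varphi$ means: either $\vdash_{DmbCcl}\varphi$, or there are $\gamma_1,\dots,\gamma_k\in\Gamma$ ($k\ge 1$ finite) with $\vdash_{DmbCcl}(\gamma_1\land\dots\land\gamma_k)\to\varphi$. **Semantics.** Let $A=\{T,t,F\}$ with $T=(1,0)$, $t=(1,1)$, $F=(0,1)$; for $a\in A$ write $a=(a_1,a_2)$. Designated values: $\mathcal{D}=\{T,t\}$. Let $\sqcap,\sqcup,\supset,{\sim}$ be the Boolean meet, join, implication and complement on $\{0,1\}$, and $\bigwedge$ the meet of a non-empty subset. For $a,b\in A$, $\emptyset\neq X\subseteq A$: - $a\,\tilde\land\,b=\{c\in A: c_1=a_1\sqcap b_1\}$; $a\,\tilde\lor\,b=\{c\in A: c_1=a_1\sqcup b_1\}$; $a\,\tilde\to\,b=\{c\in A: c_1=a_1\supset b_1\}$; - $\tilde\neg a=\{c\in A: c_1=a_2\}$; $\tilde\circ_1 a=\{c\in A: c_1={\sim}(a_1\sqcap a_2)\}$; - $\tilde{\mathsf{O}}(X)=\{c\in A: c_1=\bigwedge\{x_1:x\in X\}\}$. A swap Kripke model for $DmbCcl$ is a triple $\langle W,R,\{v_w\}_{w\in W}\rangle$ where $W\ne\emptyset$, $R\subseteq W^2$ is serial (every $w$ has some $w'$ with $wRw'$), and each $v_w:For(\Sigma)\to A$ satisfies, for all $\alpha,\beta$: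 $v_w(\alpha\#\beta)\in v_w(\alpha)\,\tilde\#\,v_w(\beta)$ for $\#\in\{\land,\lor,\to\}$; $v_w(\neg\alpha)\in\tilde\neg v_w(\alpha)$; $v_w(\circ\alpha)\in\tilde\circ_1 v_w(\alpha)$; $v_w(\mathsf{O}\alpha)\in\tilde{\mathsf{O}}(\{v_{w'}(\alpha): wRw'\})$; and, in addition, if $v_w(\alpha)=t$ then $v_w(\alpha\land\neg\alpha)=T$. $\mathcal{M},w\vDash\alpha$ means $v_w(\alpha)\in\mathcal{D}$; $\mathcal{M},w\vDash\Gamma$ means $\mathcal{M},w\vDash\gamma$ for all $\gamma\in\Gamma$. $\Gamma\vDash_{DmbCcl}\alpha$ means: for every swap Kripke model $\mathcal{M}$ for $DmbCcl$ and every world $w$ of it, $\mathcal{M},w\vDash\Gamma$ implies $\mathcal{M},w\vDash\alpha$. -}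

module Defs where

open import Level using (0ℓ; suc)
open import Data.Bool.Base as Bool using (Bool; true; false; not)
open import Data.List.NonEmpty.Base using (List⁺; foldr₁)
open import Data.List.NonEmpty.Relation.Unary.All using (All)
open import Data.Nat.Base using (ℕ)
open import Data.Product.Base using (∃-syntax; _×_)
open import Data.Sum.Base using (_⊎_)
open import Relation.Binary.Core using (Rel)
open import Relation.Binary.PropositionalEquality.Core using (_≡_)
open import Relation.Unary using (Pred; _∈_)

infix  9 ¬_ ∘_ O_
infixr 8 _∧_
infixr 7 _∨_
infixr 6 _⇒_

data For : Set where
  var         : ℕ → For
  _⇒_ _∨_ _∧_ : For → For → For
  ¬_ O_ ∘_    : For → For

bot : For → For
bot α = (α ∧ ¬ α) ∧ ∘ α

data Axiom : Pred For 0ℓ where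
  ax-k   : ∀ α β → Axiom (α ⇒ (β ⇒ α))
  ax-s   : ∀ α β γ → Axiom ((α ⇒ (β ⇒ γ)) ⇒ ((α ⇒ β) ⇒ (α ⇒ γ)))
  ax-∧i  : ∀ α β → Axiom (α ⇒ (β ⇒ (α ∧ β)))
  ax-∧e₁ : ∀ α β → Axiom ((α ∧ β) ⇒ α)
  ax-∧e₂ : ∀ α β → Axiom ((α ∧ β) ⇒ β)
  ax-∨i₁ : ∀ α β → Axiom (α ⇒ (α ∨ β))
  ax-∨i₂ : ∀ α β → Axiom (β ⇒ (α ∨ β))
  ax-∨e  : ∀ α β γ → Axiom ((α ⇒ γ) ⇒ ((β ⇒ γ) ⇒ ((α ∨ β) ⇒ γ)))
  ax-∨⇒  : ∀ α β → Axiom (α ∨ (α ⇒ β))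
  ax-EM  : ∀ α → Axiom (α ∨ ¬ α)
  ax-bc  : ∀ α β → Axiom (∘ α ⇒ (α ⇒ (¬ α ⇒ β)))
  ax-OK  : ∀ α β → Axiom (O (α ⇒ β) ⇒ (O α ⇒ O β))
  ax-OE  : ∀ α → Axiom (O (bot α) ⇒ bot α)
  ax-cl  : ∀ α → Axiom (¬ (α ∧ ¬ α) ⇒ ∘ α)

infix 4 ⊢_ _⊢_

data ⊢_ : Pred For 0ℓ where
  axiom : ∀ {φ} → Axiom φ → ⊢ φ
  mp    : ∀ {φ ψ} → ⊢ φ ⇒ ψ → ⊢ φ → ⊢ ψ
  nec   : ∀ {φ} → ⊢ φ → ⊢ O φ

-- Necessitation applies to theorems only, so the premises enter through
-- a finite non-empty conjunction, bracketed to the right.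
_⊢_ : Pred For 0ℓ → For → Set
Γ ⊢ φ = (⊢ φ) ⊎ (∃[ γs ] All Γ γs × (⊢ foldr₁ _∧_ γs ⇒ φ))

data A : Set where
  T t F : A

-- The two coordinates of the snapshots T = (1,0), t = (1,1), F = (0,1).
infix 10 _₁ _₂

_₁ : A → Bool
T ₁ = true
t ₁ = true
F ₁ = false

_₂ : A → Bool
T ₂ = false
t ₂ = true
F ₂ = true

Designated : Pred A 0ℓ
Designated a = a ≡ T ⊎ a ≡ t

infixr 5 _⊃_

_⊃_ : Bool → Bool → Bool
x ⊃ y = not x Bool.∨ y

-- b is the meet of X, as greatest lower bound in the order false ≤ true.
IsMeet : Pred Bool 0ℓ → Pred Bool 0ℓ
IsMeet X b = (∀ x → x ∈ X → b Bool.≤ x)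
           × (∀ l → (∀ x → x ∈ X → l Bool.≤ x) → l Bool.≤ b)

_∧~_ _∨~_ _⇒~_ : A → A → Pred A 0ℓ
(a ∧~ b) c = c ₁ ≡ a ₁ Bool.∧ b ₁
(a ∨~ b) c = c ₁ ≡ a ₁ Bool.∨ b ₁
(a ⇒~ b) c = c ₁ ≡ a ₁ ⊃ b ₁

¬~_ ∘~_ : A → Pred A 0ℓ
(¬~ a) c = c ₁ ≡ a ₂
(∘~ a) c = c ₁ ≡ not (a ₁ Bool.∧ a ₂)

-- Only used for non-empty X: in a model X is the set of values at the
-- successors of a world, and R is serial.
O~_ : Pred A 0ℓ → Pred A 0ℓ
(O~ X) c = IsMeet (λ b → ∃[ x ] x ∈ X × b ≡ x ₁) (c ₁)

record Model : Set (suc 0ℓ) where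
  field
    W         : Set
    inhabited : W
    R         : Rel W 0ℓ
    serial    : ∀ w → ∃[ w′ ] R w w′
    v         : W → For → A
    v-∧ : ∀ w α β → v w (α ∧ β) ∈ (v w α ∧~ v w β)
    v-∨ : ∀ w α β → v w (α ∨ β) ∈ (v w α ∨~ v w β)
    v-⇒ : ∀ w α β → v w (α ⇒ β) ∈ (v w α ⇒~ v w β)
    v-¬ : ∀ w α → v w (¬ α) ∈ (¬~ v w α)
    v-∘ : ∀ w α → v w (∘ α) ∈ (∘~ v w α)
    v-O : ∀ w α → v w (O α) ∈ (O~ (λ a → ∃[ w′ ] R w w′ × a ≡ v w′ α))
    v-t : ∀ w α → v w α ≡ t → v w (α ∧ ¬ α) ≡ T

infix 4 [_,_]⊩_ _⊨_

[_,_]⊩_ : (M : Model) → Model.W M → For → Set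
[ M , w ]⊩ α = Designated (Model.v M w α)

_⊨_ : Pred For 0ℓ → For → Set (suc 0ℓ)
Γ ⊨ φ = ∀ (M : Model) (w : Model.W M) → (∀ γ → γ ∈ Γ → [ M , w ]⊩ γ) → [ M , w ]⊩ φ

{-# OPTIONS --safe #-}

-- Canonical model construction. The worlds are the complete consistent theories,
-- related by w R u iff O α ∈ w implies α ∈ u, and a formula α gets at w the
-- snapshot whose coordinates record whether α ∈ w and whether ¬ α ∈ w. The
-- axioms EM, bc and cl are what makes these snapshots obey the tables of ¬ and ∘,
-- and cl excludes ¬ (α ∧ ¬ α) from a world that contains α and ¬ α. For O, the
-- theory { α | O α ∈ w } is consistent by O-E, so Lindenbaum's lemma gives the
-- successors needed for seriality and for refuting α when O α ∉ w.
module Submission where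

open import Defs
open import Level using (0ℓ)
open import Axiom.ExcludedMiddle using (ExcludedMiddle)
open import Data.Bool.Base as Bool using (Bool; true; false; not)
open import Data.Bool.Properties as Bool using (¬-not)
open import Data.Empty using (⊥)
open import Data.List.Base using (List; []; _∷_; [_]; concat; map; foldl; cartesianProductWith)
open import Data.List.Membership.Propositional using () renaming (_∈_ to _∈ˡ_)
open import Data.List.Membership.Propositional.Properties
  using (∈-concat⁺′; ∈-map⁺; ∈-cartesianProductWith⁺)
open import Data.List.NonEmpty.Base using (_∷_; foldr₁; _⁺++⁺_)
open import Data.List.NonEmpty.Relation.Unary.All using (All; _∷_)
open import Data.List.Relation.Unary.All using ([]; _∷_)
open import Data.List.Relation.Unary.All.Properties using (++⁺)
open import Data.List.Relation.Unary.Any using (here; there)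
open import Data.Nat.Base using (ℕ; zero; suc; _⊔_; _≤′_; ≤′-refl; ≤′-step)
open import Data.Nat.Properties using (≤⇒≤′; m≤m⊔n; m≤n⊔m)
open import Data.Product.Base using (∃-syntax; _×_; _,_; proj₁; proj₂)
open import Data.Sum.Base as Sum using (_⊎_; inj₁; inj₂)
open import Function.Base using (id)
open import Relation.Binary.PropositionalEquality
  using (_≡_; refl; sym; trans; cong; cong₂; module ≡-Reasoning)
open import Relation.Nullary using (Dec; yes; no; does; contradiction)
open import Relation.Unary using (Pred; _∈_; _∉_; _⊆_)

-- The variable is arbitrary: by `ax-bc` every `bot α` implies every formula, so a theory without
-- this one contains none of them.
falsum : For
falsum = bot (var 0)

-- Theories

-- Closed under modus ponens but not under `nec`: a formula true at a world need not be obligatory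
-- there, and only theorems may be necessitated.
record IsTheory (P : Pred For 0ℓ) : Set where
  field
    theorem : ∀ {α} → ⊢ α → α ∈ P
    app     : ∀ {α β} → (α ⇒ β) ∈ P → α ∈ P → β ∈ P

  by : ∀ {α} → Axiom α → α ∈ P
  by a = theorem (axiom a)

  weaken : ∀ {α β} → β ∈ P → (α ⇒ β) ∈ P
  weaken = app (by (ax-k _ _))

  identity : ∀ α → (α ⇒ α) ∈ P
  identity α = app (app (by (ax-s α (α ⇒ α) α)) (by (ax-k _ _))) (by (ax-k _ _))

  pair : ∀ {α β} → α ∈ P → β ∈ P → (α ∧ β) ∈ P
  pair a b = app (app (by (ax-∧i _ _)) a) b

  fst : ∀ {α β} → (α ∧ β) ∈ P → α ∈ P
  fst = app (by (ax-∧e₁ _ _))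

  snd : ∀ {α β} → (α ∧ β) ∈ P → β ∈ P
  snd = app (by (ax-∧e₂ _ _))

  cases : ∀ {α β γ} → (α ∨ β) ∈ P → (α ⇒ γ) ∈ P → (β ⇒ γ) ∈ P → γ ∈ P
  cases d f g = app (app (app (by (ax-∨e _ _ _)) f) g) d

  gentle-explosion : ∀ {α} β → ∘ α ∈ P → α ∈ P → ¬ α ∈ P → β ∈ P
  gentle-explosion β c a n = app (app (app (by (ax-bc _ β)) c) a) n

  explosion : ∀ {α} β → bot α ∈ P → β ∈ P
  explosion β b = gentle-explosion β (snd b) (fst (fst b)) (snd (fst b))

open IsTheory

⊢-isTheory : IsTheory (λ α → ⊢ α)
⊢-isTheory = record { theorem = id ; app = mp }

infixl 5 _+_

-- For a theory `P` this is the least theory containing `P` and `α`, encoded so that the deduction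
-- theorem holds by definition.
_+_ : Pred For 0ℓ → For → Pred For 0ℓ
(P + α) β = (α ⇒ β) ∈ P

module _ {P : Pred For 0ℓ} (th : IsTheory P) where

  +-isTheory : ∀ α → IsTheory (P + α)
  +-isTheory α = record
    { theorem = λ d → weaken th (theorem th d)
    ; app     = λ f a → app th (app th (by th (ax-s _ _ _)) f) a
    }

  O-isTheory : IsTheory (λ α → O α ∈ P)
  O-isTheory = record
    { theorem = λ d → theorem th (nec d)
    ; app     = λ f a → app th (app th (by th (ax-OK _ _)) f) a
    }

  -- The classical strength comes from `ax-∨⇒`, taken as `α ∨ (α ⇒ falsum)`: under the second
  -- disjunct the hypothesis yields `falsum`, which explodes to `α`.
  double-negation : ∀ {α} → ((α ⇒ falsum) ⇒ falsum) ∈ P → α ∈ P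
  double-negation {α} h =
    cases th (by th (ax-∨⇒ α falsum)) (identity th α)
      (explosion th′ α (app th′ (weaken th h) (identity th _)))
    where th′ = +-isTheory (α ⇒ falsum)

  conj-++⁻ : ∀ γ γs δs → foldr₁ _∧_ ((γ ∷ γs) ⁺++⁺ δs) ∈ P →
             foldr₁ _∧_ (γ ∷ γs) ∈ P × foldr₁ _∧_ δs ∈ P
  conj-++⁻ γ []        δs p = fst th p , snd th p
  conj-++⁻ γ (γ′ ∷ γs) δs p =
    let q , r = conj-++⁻ γ′ γs δs (snd th p) in pair th (fst th p) q , r

All-⁺++⁺ : ∀ {Γ : Pred For 0ℓ} {γs δs} → All Γ γs → All Γ δs → All Γ (γs ⁺++⁺ δs)
All-⁺++⁺ (p ∷ ps) (q ∷ qs) = p ∷ ++⁺ ps (q ∷ qs)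

-- The two derivations may rest on different finite sets of premises. Modus ponens is therefore
-- carried out under the conjunction of the appended lists, from which `conj-++⁻` recovers each
-- original conjunction.
consequences-isTheory : ∀ Γ → IsTheory (λ α → Γ ⊢ α)
consequences-isTheory Γ = record { theorem = inj₁ ; app = app-⊢ }
  where
  app-⊢ : ∀ {α β} → Γ ⊢ α ⇒ β → Γ ⊢ α → Γ ⊢ β
  app-⊢ (inj₁ f)            (inj₁ a)            = inj₁ (mp f a)
  app-⊢ (inj₁ f)            (inj₂ (δs , g , a)) =
    inj₂ (δs , g , app (+-isTheory ⊢-isTheory _) (weaken ⊢-isTheory f) a)
  app-⊢ (inj₂ (γs , g , f)) (inj₁ a)            =
    inj₂ (γs , g , app (+-isTheory ⊢-isTheory _) f (weaken ⊢-isTheory a))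
  app-⊢ (inj₂ (γ ∷ γs , g , f)) (inj₂ (δs , h , a)) =
    inj₂ ((γ ∷ γs) ⁺++⁺ δs , All-⁺++⁺ g h ,
          app th (app th (weaken ⊢-isTheory f) (proj₁ split))
                 (app th (weaken ⊢-isTheory a) (proj₂ split)))
    where
    th    = +-isTheory ⊢-isTheory (foldr₁ _∧_ ((γ ∷ γs) ⁺++⁺ δs))
    split = conj-++⁻ th γ γs δs (identity ⊢-isTheory _)

⊢-premise : ∀ {Γ γ} → γ ∈ Γ → Γ ⊢ γ
⊢-premise {γ = γ} g = inj₂ (γ ∷ [] , g ∷ [] , identity ⊢-isTheory γ)

-- Enumeration of the formulas

-- Retaining `αs` makes the levels increasing, and admitting one new variable at a time keeps them
-- finite; `var n` is thus sure to be present from level `suc n` on.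
generation : ℕ → List For → List (List For)
generation n αs =
    αs ∷ [ var n ]
  ∷ cartesianProductWith _⇒_ αs αs ∷ cartesianProductWith _∨_ αs αs ∷ cartesianProductWith _∧_ αs αs
  ∷ map ¬_ αs ∷ map O_ αs ∷ map ∘_ αs ∷ []

level : ℕ → List For
level zero    = []
level (suc n) = concat (generation n (level n))

∈-level-suc : ∀ n {αs α} → α ∈ˡ αs → αs ∈ˡ generation n (level n) → α ∈ˡ level (suc n)
∈-level-suc n p = ∈-concat⁺′ {xss = generation n (level n)} p

level-mono′ : ∀ {m n α} → m ≤′ n → α ∈ˡ level m → α ∈ˡ level n
level-mono′ ≤′-refl                   p = p
level-mono′ {n = suc n} (≤′-step m≤n) p = ∈-level-suc n (level-mono′ m≤n p) (here refl)

level-common : ∀ {α β} → ∃[ m ] α ∈ˡ level m → ∃[ n ] β ∈ˡ level n →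
               ∃[ k ] α ∈ˡ level k × β ∈ˡ level k
level-common (m , p) (n , q) =
  m ⊔ n , level-mono′ (≤⇒≤′ (m≤m⊔n m n)) p , level-mono′ (≤⇒≤′ (m≤n⊔m m n)) q

∈-level : ∀ α → ∃[ n ] α ∈ˡ level n
∈-level (var x) = suc x , ∈-level-suc x (here refl) (there (here refl))
∈-level (α ⇒ β) with k , p , q ← level-common (∈-level α) (∈-level β) =
  suc k , ∈-level-suc k (∈-cartesianProductWith⁺ _⇒_ p q) (there (there (here refl)))
∈-level (α ∨ β) with k , p , q ← level-common (∈-level α) (∈-level β) =
  suc k , ∈-level-suc k (∈-cartesianProductWith⁺ _∨_ p q) (there (there (there (here refl))))
∈-level (α ∧ β) with k , p , q ← level-common (∈-level α) (∈-level β) =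
  suc k , ∈-level-suc k (∈-cartesianProductWith⁺ _∧_ p q) (there (there (there (there (here refl)))))
∈-level (¬ α) with n , p ← ∈-level α =
  suc n , ∈-level-suc n (∈-map⁺ ¬_ p) (there (there (there (there (there (here refl))))))
∈-level (O α) with n , p ← ∈-level α =
  suc n , ∈-level-suc n (∈-map⁺ O_ p) (there (there (there (there (there (there (here refl)))))))
∈-level (∘ α) with n , p ← ∈-level α =
  suc n , ∈-level-suc n (∈-map⁺ ∘_ p) (there (there (there (there (there (there (there (here refl))))))))

-- Lindenbaum's lemma

record ConsistentTheory : Set₁ where
  field
    mem        : Pred For 0ℓ
    isTheory   : IsTheory mem
    consistent : falsum ∉ mem

  Decides : Pred For 0ℓ
  Decides α = α ∈ mem ⊎ (α ⇒ falsum) ∈ mem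

open ConsistentTheory

-- By the definition of `_+_` the hypothesis is literally the consistency of the enlarged theory.
adjoin : (Δ : ConsistentTheory) (α : For) → (α ⇒ falsum) ∉ mem Δ → ConsistentTheory
adjoin Δ α h = record { mem = mem Δ + α ; isTheory = +-isTheory (isTheory Δ) α ; consistent = h }

-- Worlds are Boolean-valued because a model needs its worlds in Set, whereas
-- Pred For 0ℓ lives in Set₁.
record World : Set where
  field
    χ           : For → Bool
    χ-isTheory  : IsTheory (λ α → χ α ≡ true)
    χ-falsum    : χ falsum ≡ false
    χ-complete  : ∀ α → χ α ≡ true ⊎ χ (α ⇒ falsum) ≡ true

open World

does-true⁺ : ∀ {P : Set} (d : Dec P) → P → does d ≡ true
does-true⁺ (yes _) _ = refl
does-true⁺ (no ¬p) p = contradiction p ¬p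

does-true⁻ : ∀ {P : Set} (d : Dec P) → does d ≡ true → P
does-true⁻ (yes p) _ = p

does-false⁺ : ∀ {P : Set} (d : Dec P) → (P → ⊥) → does d ≡ false
does-false⁺ (yes p) ¬p = contradiction p ¬p
does-false⁺ (no _)  _  = refl

module Lindenbaum (em : ExcludedMiddle 0ℓ) where

  step : ConsistentTheory → For → ConsistentTheory
  step Δ α with em {(α ⇒ falsum) ∈ mem Δ}
  ... | yes _ = Δ
  ... | no h  = adjoin Δ α h

  step-⊇ : ∀ Δ α → mem Δ ⊆ mem (step Δ α)
  step-⊇ Δ α p with em {(α ⇒ falsum) ∈ mem Δ}
  ... | yes _ = p
  ... | no _  = weaken (isTheory Δ) p

  step-decides : ∀ Δ α → Decides (step Δ α) α
  step-decides Δ α with em {(α ⇒ falsum) ∈ mem Δ}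
  ... | yes p = inj₂ p
  ... | no _  = inj₁ (identity (isTheory Δ) α)

  extend : ConsistentTheory → List For → ConsistentTheory
  extend = foldl step

  extend-⊇ : ∀ Δ αs → mem Δ ⊆ mem (extend Δ αs)
  extend-⊇ Δ []       p = p
  extend-⊇ Δ (α ∷ αs) p = extend-⊇ (step Δ α) αs (step-⊇ Δ α p)

  extend-decides : ∀ Δ {αs α} → α ∈ˡ αs → Decides (extend Δ αs) α
  extend-decides Δ {α ∷ αs} (here refl) =
    Sum.map (extend-⊇ (step Δ α) αs) (extend-⊇ (step Δ α) αs) (step-decides Δ α)
  extend-decides Δ {β ∷ αs} (there p)   = extend-decides (step Δ β) p

  module _ (Δ : ConsistentTheory) where

    -- Each stage treats a whole finite level, which takes the place of a numbering of the formulas.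
    -- Formulas recur in later levels, which is harmless because stages only grow.
    stage : ℕ → ConsistentTheory
    stage zero    = Δ
    stage (suc n) = extend (stage n) (level n)

    stage-mono′ : ∀ {m n} → m ≤′ n → mem (stage m) ⊆ mem (stage n)
    stage-mono′ ≤′-refl                   p = p
    stage-mono′ {n = suc n} (≤′-step m≤n) p = extend-⊇ (stage n) (level n) (stage-mono′ m≤n p)

    limit : Pred For 0ℓ
    limit α = ∃[ n ] α ∈ mem (stage n)

    limit-isTheory : IsTheory limit
    limit-isTheory = record
      { theorem = λ d → 0 , theorem (isTheory Δ) d
      ; app     = λ (m , f) (n , a) → m ⊔ n ,
          app (isTheory (stage (m ⊔ n))) (stage-mono′ (≤⇒≤′ (m≤m⊔n m n)) f)
                                         (stage-mono′ (≤⇒≤′ (m≤n⊔m m n)) a)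
      }

    limit-complete : ∀ α → α ∈ limit ⊎ (α ⇒ falsum) ∈ limit
    limit-complete α with n , p ← ∈-level α =
      Sum.map (suc n ,_) (suc n ,_) (extend-decides (stage n) p)

    completion : World
    completion = record
      { χ          = λ α → does (em {α ∈ limit})
      ; χ-isTheory = record
        { theorem = λ d → does-true⁺ em (theorem limit-isTheory d)
        ; app     = λ f a → does-true⁺ em (app limit-isTheory (does-true⁻ em f) (does-true⁻ em a))
        }
      -- Membership in the limit is witnessed at a finite stage, so an inconsistency would already
      -- appear there.
      ; χ-falsum   = does-false⁺ em λ (n , p) → consistent (stage n) p
      ; χ-complete = λ α → Sum.map (does-true⁺ em) (does-true⁺ em) (limit-complete α)
      }

    completion-⊇ : ∀ {α} → α ∈ mem Δ → χ completion α ≡ true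
    completion-⊇ p = does-true⁺ em (0 , p)

  -- The world completes `Δ` with `α ⇒ falsum` adjoined; were that inconsistent, `double-negation`
  -- would put `α` into `Δ`.
  refutation : (Δ : ConsistentTheory) (α : For) → α ∉ mem Δ →
               ∃[ w ] (∀ {β} → β ∈ mem Δ → χ w β ≡ true) × χ w α ≡ false
  refutation Δ α h = w , (λ p → completion-⊇ Δ′ (weaken (isTheory Δ) p)) , ¬-not α∉w
    where
    Δ′ = adjoin Δ (α ⇒ falsum) (λ p → h (double-negation (isTheory Δ) p))
    w  = completion Δ′

    α∉w : χ w α ≡ true → ⊥
    α∉w p = contradiction
      (trans (sym (χ-falsum w))
             (app (χ-isTheory w) (completion-⊇ Δ′ (identity (isTheory Δ) (α ⇒ falsum))) p))
      λ ()

-- Truth in a world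

module _ (w : World) where
  private
    th : IsTheory (λ α → χ w α ≡ true)
    th = χ-isTheory w

  χ-consistent : χ w falsum ≡ true → ⊥
  χ-consistent p = contradiction (trans (sym (χ-falsum w)) p) λ ()

  χ-refute : ∀ {α} → χ w α ≡ false → χ w (α ⇒ falsum) ≡ true
  χ-refute {α} p with χ-complete w α
  ... | inj₁ q = contradiction (trans (sym p) q) λ ()
  ... | inj₂ q = q

  χ-∧ : ∀ α β → χ w (α ∧ β) ≡ χ w α Bool.∧ χ w β
  χ-∧ α β with χ w α in p | χ w β in q
  ... | true  | true  = pair th p q
  ... | true  | false = ¬-not λ r → contradiction (trans (sym q) (snd th r)) λ ()
  ... | false | _     = ¬-not λ r → contradiction (trans (sym p) (fst th r)) λ ()

  χ-∨ : ∀ α β → χ w (α ∨ β) ≡ χ w α Bool.∨ χ w β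
  χ-∨ α β with χ w α in p | χ w β in q
  ... | true  | _     = app th (by th (ax-∨i₁ _ _)) p
  ... | false | true  = app th (by th (ax-∨i₂ _ _)) q
  ... | false | false = ¬-not λ r → χ-consistent (cases th r (χ-refute p) (χ-refute q))

  χ-⇒ : ∀ α β → χ w (α ⇒ β) ≡ χ w α ⊃ χ w β
  χ-⇒ α β with χ w α in p | χ w β in q
  ... | true  | true  = weaken th q
  ... | true  | false = ¬-not λ r → contradiction (trans (sym q) (app th r p)) λ ()
  -- That `α ⇒ falsum` holds at `w` is read as `falsum` belonging to the theory of `w` with `α`
  -- adjoined, where it explodes to `β`.
  ... | false | _     = explosion (+-isTheory th α) β (χ-refute p)

  χ-EM : ∀ α → χ w α ≡ false → χ w (¬ α) ≡ true
  χ-EM α p = trans (sym (cong (Bool._∨ χ w (¬ α)) p)) (trans (sym (χ-∨ α (¬ α))) (by th (ax-EM α)))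

  -- If both conjuncts hold, `ax-bc` excludes `∘ α`. Otherwise `α ∧ ¬ α` fails, so its negation
  -- holds by excluded middle in the logic, and `ax-cl` turns that into `∘ α`.
  χ-∘ : ∀ α → χ w (∘ α) ≡ not (χ w α Bool.∧ χ w (¬ α))
  χ-∘ α with χ w α Bool.∧ χ w (¬ α) in p
  ... | true  = ¬-not λ r → χ-consistent (gentle-explosion th falsum r (fst th q) (snd th q))
    where q = trans (χ-∧ α (¬ α)) p
  ... | false = app th (by th (ax-cl α)) (χ-EM (α ∧ ¬ α) (trans (χ-∧ α (¬ α)) p))

  χ-cl : ∀ α → χ w α ≡ true → χ w (¬ α) ≡ true → χ w (¬ (α ∧ ¬ α)) ≡ false
  χ-cl α p q = ¬-not λ r → χ-consistent (gentle-explosion th falsum (app th (by th (ax-cl α)) r) p q)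

-- The canonical model

snapshot : Bool → Bool → A
snapshot true  false = T
snapshot true  true  = t
-- The pair (0,0) is no element of `A`; it is sent to `F` by default. `χ-EM` shows that it never
-- arises at a world, which is the side condition of `snapshot-₂`.
snapshot false _     = F

snapshot-₁ : ∀ x y → snapshot x y ₁ ≡ x
snapshot-₁ true  false = refl
snapshot-₁ true  true  = refl
snapshot-₁ false _     = refl

snapshot-₂ : ∀ x y → (x ≡ false → y ≡ true) → snapshot x y ₂ ≡ y
snapshot-₂ true  false _ = refl
snapshot-₂ true  true  _ = refl
snapshot-₂ false y     h = sym (h refl)

snapshot≡t : ∀ x y → snapshot x y ≡ t → x ≡ true × y ≡ true
snapshot≡t true true _ = refl , refl

designated⁺ : ∀ a → a ₁ ≡ true → Designated a
designated⁺ T _ = inj₁ refl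
designated⁺ t _ = inj₂ refl

designated⁻ : ∀ {a} → Designated a → a ₁ ≡ true
designated⁻ (inj₁ refl) = refl
designated⁻ (inj₂ refl) = refl

value : World → For → A
value w α = snapshot (χ w α) (χ w (¬ α))

value-₁ : ∀ w α → value w α ₁ ≡ χ w α
value-₁ w α = snapshot-₁ (χ w α) (χ w (¬ α))

value-₂ : ∀ w α → value w α ₂ ≡ χ w (¬ α)
value-₂ w α = snapshot-₂ (χ w α) (χ w (¬ α)) (χ-EM w α)

-- The multioperations of the three binary connectives restrict only the first coordinate, so one
-- argument covers them all.
value-binary : (_∙_ : For → For → For) (_⋆_ : Bool → Bool → Bool) →
               (∀ w α β → χ w (α ∙ β) ≡ χ w α ⋆ χ w β) →
               ∀ w α β → value w (α ∙ β) ₁ ≡ (value w α ₁) ⋆ (value w β ₁)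
value-binary _∙_ _⋆_ h w α β = begin
  value w (α ∙ β) ₁             ≡⟨ value-₁ w (α ∙ β) ⟩
  χ w (α ∙ β)                   ≡⟨ h w α β ⟩
  χ w α ⋆ χ w β                 ≡⟨ cong₂ _⋆_ (value-₁ w α) (value-₁ w β) ⟨
  (value w α ₁) ⋆ (value w β ₁) ∎
  where open ≡-Reasoning

value-∘ : ∀ w α → value w (∘ α) ₁ ≡ not (value w α ₁ Bool.∧ value w α ₂)
value-∘ w α = begin
  value w (∘ α) ₁                           ≡⟨ value-₁ w (∘ α) ⟩
  χ w (∘ α)                                 ≡⟨ χ-∘ w α ⟩
  not (χ w α Bool.∧ χ w (¬ α))              ≡⟨ cong not (cong₂ Bool._∧_ (value-₁ w α) (value-₂ w α)) ⟨
  not (value w α ₁ Bool.∧ value w α ₂)      ∎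
  where open ≡-Reasoning

value-t : ∀ w α → value w α ≡ t → value w (α ∧ ¬ α) ≡ T
value-t w α e with p , q ← snapshot≡t _ _ e =
  cong₂ snapshot (pair (χ-isTheory w) p q) (χ-cl w α p q)

infix 4 _▷_

_▷_ : World → World → Set
w ▷ u = ∀ {α} → χ w (O α) ≡ true → χ u α ≡ true

obligations : World → ConsistentTheory
obligations w = record
  { mem        = λ α → χ w (O α) ≡ true
  ; isTheory   = O-isTheory (χ-isTheory w)
  ; consistent = λ p → χ-consistent w (app (χ-isTheory w) (by (χ-isTheory w) (ax-OE _)) p)
  }

module Canonical (em : ExcludedMiddle 0ℓ) where
  open Lindenbaum em

  ▷-serial : ∀ w → ∃[ u ] w ▷ u
  ▷-serial w = completion (obligations w) , completion-⊇ (obligations w)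

  value-O : ∀ w α → value w (O α) ∈ (O~ (λ a → ∃[ u ] (w ▷ u) × a ≡ value u α))
  value-O w α rewrite value-₁ w (O α) = lower , greatest
    where
    Values : Pred Bool 0ℓ
    Values b = ∃[ x ] (∃[ u ] (w ▷ u) × x ≡ value u α) × b ≡ x ₁

    lower : ∀ b → b ∈ Values → χ w (O α) Bool.≤ b
    lower _ (_ , (u , R , refl) , refl) rewrite value-₁ u α with χ w (O α) in p
    ... | true  rewrite R p = Bool.b≤b
    ... | false = Bool.≤-minimum _

    greatest : ∀ l → (∀ b → b ∈ Values → l Bool.≤ b) → l Bool.≤ χ w (O α)
    greatest l h with χ w (O α) in p
    ... | true  = Bool.≤-maximum l
    -- Since `O α` fails at `w`, `α` lies outside `obligations w`. The containment returned by
    -- `refutation` is by definition `w ▷ u`, so `u` is a successor with first coordinate `false` at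
    -- `α`, and this bounds `l`.
    ... | false with refutation (obligations w) α (λ q → contradiction (trans (sym p) q) λ ())
    ...   | u , R , q with h _ (_ , (u , R , refl) , refl)
    ...     | l≤ rewrite value-₁ u α | q = l≤

  canonical : World → Model
  canonical w₀ = record
    { W         = World
    ; inhabited = w₀
    ; R         = _▷_
    ; serial    = ▷-serial
    ; v         = value
    ; v-∧       = value-binary _∧_ Bool._∧_ χ-∧
    ; v-∨       = value-binary _∨_ Bool._∨_ χ-∨
    ; v-⇒       = value-binary _⇒_ _⊃_ χ-⇒
    ; v-¬       = λ w α → trans (value-₁ w (¬ α)) (sym (value-₂ w α))
    ; v-∘       = value-∘
    ; v-O       = value-O
    ; v-t       = value-t
    }

theorem4p8 : ExcludedMiddle 0ℓ → (Γ : Pred For 0ℓ) (φ : For) → Γ ⊨ φ → Γ ⊢ φ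
theorem4p8 em Γ φ Γ⊨φ with em {Γ ⊢ φ}
... | yes Γ⊢φ = Γ⊢φ
-- The consequences of `Γ` form a theory omitting `φ`, consistent because `falsum` would explode to
-- `φ`. A world extending it and refuting `φ` designates all of `Γ` in the canonical model, against
-- `Γ⊨φ`.
... | no  Γ⊬φ = contradiction (trans (sym φ∉w) φ∈w) λ ()
  where
  Δ : ConsistentTheory
  Δ = record
    { mem        = λ α → Γ ⊢ α
    ; isTheory   = consequences-isTheory Γ
    ; consistent = λ p → Γ⊬φ (explosion (consequences-isTheory Γ) φ p)
    }

  countermodel = Lindenbaum.refutation em Δ φ Γ⊬φ
  w            = proj₁ countermodel
  Δ⊆w          = proj₁ (proj₂ countermodel)
  φ∉w          = proj₂ (proj₂ countermodel)

  Γ-holds : ∀ γ → γ ∈ Γ → [ Canonical.canonical em w , w ]⊩ γ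
  Γ-holds γ γ∈Γ = designated⁺ _ (trans (value-₁ w γ) (Δ⊆w (⊢-premise γ∈Γ)))

  φ∈w : χ w φ ≡ true
  φ∈w = trans (sym (value-₁ w φ)) (designated⁻ (Γ⊨φ (Canonical.canonical em w) w Γ-holds))
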